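{- The frame properties of transitivity and Euclidicity are not definable in $\mathcal{L}(\blacktriangle)$; that is, for each of these two properties there is no set $\Gamma\subseteq\mathcal{L}(\blacktriangle)$ such that for every frame $\mathcal{F}$, $\mathcal{F}$ has the property iff $\mathcal{F}\vDash\Gamma$.
   Context: Let $\mathbf{P}$ be a set of propositional variables. $\mathcal{L}(\blacktriangle)$-formulas: $\varphi::=\top\mid p\mid\neg\varphi\mid(\varphi\land\varphi)\mid\blacktriangle\varphi$ with $p\in\mathbf{P}$. A frame is $\mathcal{F}=\langle S,R\rangle$ with $S$ nonempty and $R\subseteq S\times S$; a model based on $\mathcal{F}$ is $\mathcal{M}=\langle S,R,V\rangle$ with $V:\mathbf{P}\to\mathcal{P}(S)$. Truth: $\top$, variables, $\neg,\land$ as usual; $\mathcal{M},s\vDash\blacktriangle\varphi$ iff (if $\mathcal{M},s\vDash\varphi$ then $\mathcal{M},t\vDash\varphi$ for all $t$ with $sRt$) and (if $\mathcal{M},s\nvDash\varphi$ then $\mathcal{M},t\nvDash\varphi$ for all $t$ with $sRt$). $\mathcal{F}\vDash\varphi$ means $\mathcal{M},s\vDash\varphi$ for every model $\mathcal{M}$ based on $\mathcal{F}$ and every $s\in S$; $\mathcal{F}\vDash\Gamma$ means $\mathcal{F}\vDash\varphi$ for all $\varphi\in\Gamma$. Euclidean: $sRt$ and $sRu$ imply $tRu$. -}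

module Defs where

open import Data.Product using (_×_; Σ-syntax)
open import Data.Unit.Polymorphic using (⊤)
open import Function.Bundles using (_⇔_)
open import Level using (Level; suc; _⊔_)
open import Relation.Binary.Core using (Rel)
open import Relation.Binary.Definitions using (Transitive)
open import Relation.Nullary.Negation using (¬_)
open import Relation.Unary using (Pred; _∈_)

private
  variable
    p ℓ : Level
    P : Set p

infixr 6 _∧′_
infix  7 ¬′_ ▲_

data Formula (P : Set p) : Set p where
  ⊤′   : Formula P
  var  : P → Formula P
  ¬′_  : Formula P → Formula P
  _∧′_ : Formula P → Formula P → Formula P
  ▲_   : Formula P → Formula P

record Frame (ℓ : Level) : Set (suc ℓ) where
  field
    S        : Set ℓ
    nonempty : S
    R        : Rel S ℓ

record Model (P : Set p) (F : Frame ℓ) : Set (p ⊔ suc ℓ) where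
  open Frame F
  field
    V : P → Pred S ℓ

-- Truth is an arbitrary (not necessarily decidable) type, so no form of
-- excluded middle is built into the semantics.
module _ {F : Frame ℓ} where
  open Frame F

  infix 4 _,_⊨_
  _,_⊨_ : Model P F → S → Formula P → Set ℓ
  M , s ⊨ ⊤′     = ⊤
  M , s ⊨ var q  = s ∈ Model.V M q
  M , s ⊨ ¬′ φ   = ¬ (M , s ⊨ φ)
  M , s ⊨ φ ∧′ ψ = (M , s ⊨ φ) × (M , s ⊨ ψ)
  M , s ⊨ ▲ φ    = (M , s ⊨ φ → ∀ t → R s t → M , t ⊨ φ)
                 × (¬ (M , s ⊨ φ) → ∀ t → R s t → ¬ (M , t ⊨ φ))

infix 4 _⊨ᶠ_ _⊨ˢ_

_⊨ᶠ_ : {P : Set p} → Frame ℓ → Formula P → Set (p ⊔ suc ℓ)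
_⊨ᶠ_ {P = P} F φ = (M : Model P F) (s : Frame.S F) → M , s ⊨ φ

_⊨ˢ_ : ∀ {γ} {P : Set p} → Frame ℓ → Pred (Formula P) γ → Set (p ⊔ γ ⊔ suc ℓ)
F ⊨ˢ Γ = ∀ φ → φ ∈ Γ → F ⊨ᶠ φ

Definable : (P : Set p) (γ : Level) → Pred (Frame ℓ) ℓ → Set (p ⊔ suc γ ⊔ suc ℓ)
Definable {ℓ = ℓ} P γ Prop =
  Σ[ Γ ∈ Pred (Formula P) γ ] ((F : Frame ℓ) → Prop F ⇔ (F ⊨ˢ Γ))

TransitiveFrame : Pred (Frame ℓ) ℓ
TransitiveFrame F = Transitive (Frame.R F)

Euclidean : {A : Set ℓ} → Rel A ℓ → Set ℓ
Euclidean _∼_ = ∀ {s t u} → s ∼ t → s ∼ u → t ∼ u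

EuclideanFrame : Pred (Frame ℓ) ℓ
EuclideanFrame F = Euclidean (Frame.R F)

{-# OPTIONS --safe #-}
-- ▲ cannot see reflexive arrows, so a frame and its reflexive closure validate
-- the same formulas. On a two-point set, _≢_ is neither transitive nor
-- Euclidean, but its reflexive closure is total and hence both.
module Submission where

open import Defs
open import Data.Bool.Base using (Bool; true; false)
open import Data.Product using (_×_; _,_; proj₁; proj₂)
open import Function.Bundles using (_⇔_; mk⇔; module Equivalence)
open import Function.Construct.Identity using (⇔-id)
open import Level using (Level; Lift; lift)
open import Relation.Binary.Construct.Closure.Reflexive using (ReflClosure; [_]; refl)
open import Relation.Binary.PropositionalEquality.Core as ≡ using (_≢_)
open import Relation.Nullary.Negation using (¬_)
open import Relation.Unary using (Pred)

open Equivalence using (to; from)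

private
  variable
    p ℓ γ : Level
    P : Set p

reflexiveFrame : Frame ℓ → Frame ℓ
reflexiveFrame F = record
  { S = S ; nonempty = nonempty ; R = ReflClosure R }
  where open Frame F

reflexiveModel : {F : Frame ℓ} → Model P F → Model P (reflexiveFrame F)
reflexiveModel M = record { V = Model.V M }

-- By induction on the formula. Both directions are carried together because `¬′` swaps them and `▲`
-- uses its argument both as a premise and as a conclusion.
reflexive-⊨ : {F : Frame ℓ} (M : Model P F) (φ : Formula P) (s : Frame.S F) →
              M , s ⊨ φ ⇔ reflexiveModel M , s ⊨ φ
reflexive-⊨ M ⊤′       s = ⇔-id _
reflexive-⊨ M (var q)  s = ⇔-id _
reflexive-⊨ M (¬′ φ)   s = mk⇔ (λ ¬φ φ⁺ → ¬φ (from ih φ⁺)) (λ ¬φ⁺ x → ¬φ⁺ (to ih x))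
  where ih = reflexive-⊨ M φ s
reflexive-⊨ M (φ ∧′ ψ) s = mk⇔
  (λ (x , y) → to ihφ x , to ihψ y)
  (λ (x , y) → from ihφ x , from ihψ y)
  where
  ihφ = reflexive-⊨ M φ s
  ihψ = reflexive-⊨ M ψ s
reflexive-⊨ {F = F} M (▲ φ) s = mk⇔
  (λ ▲φ → preserve ▲φ , reflect ▲φ)
  (λ (pres , refuted) →
    (λ x t r → from (ih t) (pres (to (ih s) x) t [ r ])) ,
    (λ ¬x t r y → refuted (λ x → ¬x (from (ih s) x)) t [ r ] (to (ih t) y)))
  where
  open Frame F
  M⁺ = reflexiveModel M
  ih = reflexive-⊨ M φ

  preserve : M , s ⊨ ▲ φ → M⁺ , s ⊨ φ → ∀ t → ReflClosure R s t → M⁺ , t ⊨ φ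
  preserve ▲φ x t [ r ] = to (ih t) (proj₁ ▲φ (from (ih s) x) t r)
  -- Along an added arrow `t` is `s`, so the premise is already the conclusion; likewise in
  -- `reflect`.
  preserve ▲φ x t refl  = x

  reflect : M , s ⊨ ▲ φ → ¬ (M⁺ , s ⊨ φ) → ∀ t → ReflClosure R s t → ¬ (M⁺ , t ⊨ φ)
  reflect ▲φ ¬x t [ r ] y = proj₂ ▲φ (λ x → ¬x (to (ih s) x)) t r (from (ih t) y)
  reflect ▲φ ¬x t refl    = ¬x

-- Each model on `F` has the same valuation and truths as a model on the closure, so a countermodel
-- on `F` would also be one there.
reflexive-⊨ˢ : (F : Frame ℓ) (Γ : Pred (Formula P) γ) → reflexiveFrame F ⊨ˢ Γ → F ⊨ˢ Γ
reflexive-⊨ˢ F Γ valid φ φ∈Γ M s =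
  from (reflexive-⊨ M φ s) (valid φ φ∈Γ (reflexiveModel M) s)

undefinable : (Prop : Pred (Frame ℓ) ℓ) (F : Frame ℓ) →
              Prop (reflexiveFrame F) → ¬ Prop F → ¬ Definable P γ Prop
undefinable Prop F holds fails (Γ , defines) =
  fails (from (defines F) (reflexive-⊨ˢ F Γ (to (defines (reflexiveFrame F)) holds)))

-- `Lift` puts the points, and with them `_≢_`, at any chosen level.
swapFrame : ∀ ℓ → Frame ℓ
swapFrame ℓ = record { S = Lift ℓ Bool ; nonempty = lift true ; R = _≢_ }

swap-reflexive-total : (s t : Lift ℓ Bool) → ReflClosure _≢_ s t
swap-reflexive-total (lift true)  (lift true)  = refl
swap-reflexive-total (lift true)  (lift false) = [ (λ ()) ]
swap-reflexive-total (lift false) (lift true)  = [ (λ ()) ]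
swap-reflexive-total (lift false) (lift false) = refl

swap-¬transitive : ¬ TransitiveFrame (swapFrame ℓ)
swap-¬transitive trans =
  -- Going across and back would give a loop at `lift true`.
  trans {lift true} {lift false} {lift true} (λ ()) (λ ()) ≡.refl

swap-¬euclidean : ¬ EuclideanFrame (swapFrame ℓ)
swap-¬euclidean eucl =
  -- Taking the same arrow twice would force a loop at its target.
  eucl {lift true} {lift false} {lift false} (λ ()) (λ ()) ≡.refl

proposition19 : {p : Level} (P : Set p) (ℓ γ : Level) →
    (¬ Definable P γ (TransitiveFrame {ℓ})) × (¬ Definable P γ (EuclideanFrame {ℓ}))
proposition19 P ℓ γ =
  undefinable TransitiveFrame (swapFrame ℓ)
    -- Each property only asks for one arrow, which totality supplies.
    (λ _ _ → swap-reflexive-total _ _) swap-¬transitive ,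
  undefinable EuclideanFrame (swapFrame ℓ)
    (λ _ _ → swap-reflexive-total _ _) swap-¬euclidean
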